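{- Let $n\ge 1$ and let $\pi=\pi_1\pi_2\cdots\pi_n\in\mathcal{S}_n$ have left border numbers $a_1,a_2,\ldots,a_n$. Let $a$ be the sequence obtained by arranging $a_2,a_3,\ldots,a_n$ in (weakly) decreasing order. Then $\Lambda(\pi)=a$.
   Context: $\mathcal{S}_n$ is the set of permutations $\pi=\pi_1\cdots\pi_n$ of $[n]=\{1,\ldots,n\}$, written as words. The standardization $w^{\ast}$ of a word $w$ of $m$ distinct positive integers is the permutation in $\mathcal{S}_m$ obtained by replacing the $i$th smallest letter by $i$. The map $D$ from permutations in $\mathcal{S}_n$ to Dyck words of length $2n$ in the letters $\mathsf{u}$ (up step $(0,1)$) and $\mathsf{r}$ (right step $(1,0)$) is defined recursively by $D(\emptyset)=\emptyset$ and, for $\pi=\pi_L\,n\,\pi_R\in\mathcal{S}_n$ with $n\ge1$ ($\pi_L,\pi_R$ the possibly empty words to the left and right of the letter $n$), $D(\pi)=\mathsf{u}\,D(\pi_L^{\ast})\,\mathsf{r}\,D(\pi_R^{\ast})$. $\Lambda(\pi)$ is the partition with exactly $n-1$ parts (parts equal to $0$ allowed) whose Young diagram is the region above the path $D(\pi)$ drawn from $(0,0)$ to $(n,n)$, i.e. bounded by the path and the lines $x=0$, $y=n$. Equivalently, the parts of $\Lambda(\pi)$ are, in weakly decreasing order, the numbers of letters $\mathsf{r}$ preceding the 2nd, 3rd, ..., $n$th letter $\mathsf{u}$ in $D(\pi)$. Example: for $\pi=5\,3\,1\,4\,8\,2\,7\,6$, $\Lambda(\pi)=(7,5,5,2,1,1,0)$.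 The left border number $a_i$ of $\pi$ is the largest position $m<i$ with $\pi_m>\pi_i$, or $0$ if no such position exists. -}

module Defs where

open import Data.Fin using (Fin; toℕ)
open import Data.List using (List; []; _∷_; _++_; [_]; allFin; applyUpTo; drop; filter; length; lookup; map; reverse; upTo)
open import Data.List.Extrema.Nat using (max)
open import Data.List.Membership.Propositional.Properties using (∈-∃++; ∈-map⁺; ∈-upTo⁺)
open import Data.List.Properties using (length-++; length-map; length-upTo; map-upTo; map-cong; filter-none; filter-accept)
open import Data.List.Relation.Binary.Permutation.Propositional using (_↭_; ↭-sym; ↭-trans; ↭-reflexive; ↭⇒↭ₛ)
open import Data.List.Relation.Binary.Permutation.Propositional.Properties using (∈-resp-↭; ↭-length; filter-↭; map⁺)
import Data.List.Relation.Binary.Permutation.Setoid.Properties as SetoidPerm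
open import Data.List.Relation.Unary.All as All using (All; []; _∷_)
import Data.List.Relation.Unary.All.Properties as All
open import Data.List.Relation.Unary.AllPairs as AllPairs using (AllPairs; []; _∷_)
open import Data.List.Relation.Unary.Linked.Properties using (Linked⇒AllPairs)
open import Data.List.Relation.Unary.Unique.Propositional using (Unique)
import Data.List.Relation.Unary.Unique.Propositional.Properties as Unique
import Data.List.Sort as Sort
open import Data.List.Sort.Base using (module SortingAlgorithm)
open import Data.Nat using (ℕ; zero; suc; _+_; _≤_; _<_; _≤?_; _<?_; s≤s)
open import Data.Nat.Induction using (Acc; acc; <-wellFounded)
open import Data.Nat.Properties using (≤-decTotalOrder; ≤-trans; ≤-refl; <⇒≤; <⇒≱; ≤∧≢⇒<; m≤m+n; m≤n+m; suc-injective; +-suc; n<1+n)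
open import Data.List.Sort.InsertionSort ≤-decTotalOrder using (insertionSort)
open import Data.Product using (_,_)
open import Function using (_∘_)
open import Relation.Binary.Properties.DecTotalOrder ≤-decTotalOrder using (≥-decTotalOrder)
open import Relation.Binary.PropositionalEquality using (_≡_; refl; sym; trans; cong; cong₂; subst; setoid)
open import Relation.Nullary.Decidable using (_×-dec_)

-- Permutations of {1, …, n}, written as words.
record 𝒮 (n : ℕ) : Set where
  constructor permutation
  field
    word          : List ℕ
    isPermutation : word ↭ map suc (upTo n)

open 𝒮 public

-- In a word of distinct letters, the i-th smallest letter is the one of rank i.
rank : List ℕ → ℕ → ℕ
rank w x = length (filter (_≤? x) w)

standardize : List ℕ → List ℕ
standardize w = map (rank w) w

private
  -- `Data.List.Sort.sort` is abstract; this algorithm lets `D` below compute.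
  module ≤-Sort = SortingAlgorithm insertionSort

  Unique-resp-↭ : ∀ {xs ys : List ℕ} → xs ↭ ys → Unique xs → Unique ys
  Unique-resp-↭ p = SetoidPerm.Unique-resp-↭ (setoid ℕ) (↭⇒↭ₛ p)

  map-rank-sorted : ∀ xs → AllPairs _<_ xs → map (rank xs) xs ≡ map suc (upTo (length xs))
  map-rank-sorted [] [] = refl
  map-rank-sorted (x ∷ xs) (x<xs ∷ xs↗) = cong₂ _∷_ headRank tailRanks
    where
    headRank : rank (x ∷ xs) x ≡ 1
    headRank = trans (cong length (filter-accept (_≤? x) {xs = xs} ≤-refl))
                     (cong (suc ∘ length) (filter-none (_≤? x) (All.map <⇒≱ x<xs)))

    shift : ∀ {ys} → All (x <_) ys → map (rank (x ∷ xs)) ys ≡ map suc (map (rank xs) ys)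
    shift [] = refl
    shift (x<y ∷ x<ys) =
      cong₂ _∷_ (cong length (filter-accept (_≤? _) {xs = xs} (<⇒≤ x<y))) (shift x<ys)

    tailRanks : map (rank (x ∷ xs)) xs ≡ map suc (applyUpTo suc (length xs))
    tailRanks = trans (shift x<xs)
      (cong (map suc) (trans (map-rank-sorted xs xs↗) (map-upTo suc (length xs))))

standardize-isPermutation : ∀ {w} → Unique w → standardize w ↭ map suc (upTo (length w))
standardize-isPermutation {w} w! =
  ↭-trans (map⁺ (rank w) w↭s)
    (↭-reflexive (trans (map-cong (λ x → ↭-length (filter-↭ (_≤? x) w↭s)) s)
      (trans (map-rank-sorted s s↗) (cong (map suc ∘ upTo) (sym (↭-length w↭s))))))
  where
  s : List ℕ
  s = ≤-Sort.sort w

  w↭s : w ↭ s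
  w↭s = ↭-sym (≤-Sort.sort-↭ w)

  s↗ : AllPairs _<_ s
  s↗ = AllPairs.zipWith (λ (x≤y , x≢y) → ≤∧≢⇒< x≤y x≢y)
         (Linked⇒AllPairs ≤-trans (≤-Sort.sort-↗ w) , Unique-resp-↭ w↭s w!)

-- The standardization w* of a word w of distinct letters.
_* : (w : List ℕ) {w! : Unique w} → 𝒮 (length w)
_* w {w!} = permutation (standardize w) (standardize-isPermutation w!)

private
  AllPairs-++⁻ˡ : ∀ {R : ℕ → ℕ → Set} xs {ys} → AllPairs R (xs ++ ys) → AllPairs R xs
  AllPairs-++⁻ˡ []       _        = []
  AllPairs-++⁻ˡ (x ∷ xs) (p ∷ ps) = All.++⁻ˡ xs p ∷ AllPairs-++⁻ˡ xs ps

  AllPairs-++⁻ʳ : ∀ {R : ℕ → ℕ → Set} xs {ys} → AllPairs R (xs ++ ys) → AllPairs R ys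
  AllPairs-++⁻ʳ []       ps       = ps
  AllPairs-++⁻ʳ (x ∷ xs) (_ ∷ ps) = AllPairs-++⁻ʳ xs ps

word-unique : ∀ {n} (π : 𝒮 n) → Unique (word π)
word-unique {n} π =
  Unique-resp-↭ (↭-sym (isPermutation π)) (Unique.map⁺ suc-injective (Unique.upTo⁺ n))

word-length : ∀ {n} (π : 𝒮 n) → length (word π) ≡ n
word-length {n} π =
  trans (↭-length (isPermutation π)) (trans (length-map suc (upTo n)) (length-upTo n))

-- A permutation of {1, …, n} with n ≥ 1 has the form π = π_L n π_R.
record Decomposition {n : ℕ} (π : 𝒮 (suc n)) : Set where
  field
    πL πR  : List ℕ
    word-≡ : word π ≡ πL ++ [ suc n ] ++ πR

  πL! : Unique πL
  πL! = AllPairs-++⁻ˡ πL (subst Unique word-≡ (word-unique π))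

  πR! : Unique πR
  πR! = AllPairs.tail (AllPairs-++⁻ʳ πL (subst Unique word-≡ (word-unique π)))

  length-+ : length πL + length πR ≡ n
  length-+ = suc-injective (trans (sym (+-suc (length πL) (length πR)))
    (trans (sym (length-++ πL)) (trans (cong length (sym word-≡)) (word-length π))))

  πL-shorter : length πL < suc n
  πL-shorter = s≤s (subst (length πL ≤_) length-+ (m≤m+n _ _))

  πR-shorter : length πR < suc n
  πR-shorter = s≤s (subst (length πR ≤_) length-+ (m≤n+m _ _))

decompose : ∀ {n} (π : 𝒮 (suc n)) → Decomposition π
decompose {n} π with ∈-∃++ (∈-resp-↭ (↭-sym (isPermutation π)) (∈-map⁺ suc (∈-upTo⁺ (n<1+n n))))
... | πL , πR , eq = record { πL = πL ; πR = πR ; word-≡ = eq }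

data Step : Set where
  u r : Step

D-rec : ∀ n → Acc _<_ n → 𝒮 n → List Step
D-rec zero    _        _ = []
D-rec (suc n) (acc rs) π =
  u ∷ D-rec (length πL) (rs πL-shorter) ((πL *) {πL!}) ++
  r ∷ D-rec (length πR) (rs πR-shorter) ((πR *) {πR!})
  where open Decomposition (decompose π)

D : ∀ {n} → 𝒮 n → List Step
D {n} = D-rec n (<-wellFounded n)

-- For each u of a path, from left to right, the number of r's before it, where
-- k steps r have already been made.  This is the length of the row between the
-- line x = 0 and that u; successive u's bound successive rows from the bottom up.
rowLengths : ℕ → List Step → List ℕ
rowLengths k []      = []
rowLengths k (u ∷ p) = k ∷ rowLengths k p
rowLengths k (r ∷ p) = rowLengths (suc k) p

-- The bottom row, which is always empty, is not counted, and the remaining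
-- rows are listed from the top down.
Λ : ∀ {n} → 𝒮 n → List ℕ
Λ π = reverse (drop 1 (rowLengths 0 (D π)))

-- Positions are counted from 1.
position : ∀ {n} → Fin n → ℕ
position i = suc (toℕ i)

-- The largest position m < i with π_m > π_i.  The base value 0 of the maximum
-- is attained exactly when there is no such position.
leftBorder : (w : List ℕ) → Fin (length w) → ℕ
leftBorder w i =
  max 0 (map position
    (filter (λ m → (position m <? position i) ×-dec (lookup w i <? lookup w m))
      (allFin (length w))))

leftBorders : ∀ {n} → 𝒮 n → List ℕ
leftBorders π = map (leftBorder (word π)) (allFin (length (word π)))

open Sort ≥-decTotalOrder public
  using ()
  renaming (sort to sortDecreasing)

{-# OPTIONS --safe #-}
-- Let L n R be the word of π and let b be the list of its left border numbers.
-- The letter n is larger than every other letter, so its left border number is 0 and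
-- it does not affect L, while for a letter of R the search to the left stops at n at
-- the latest.  Hence b(L n R) = b(L), 0, |L| + 1 + b(R).  The r's before the u's
-- of u D(L) r D(R) number 0, then those of D(L), then |L| + 1 plus those of D(R).
-- So the two lists agree up to order, and since the second one is weakly increasing for
-- every path, its reverse is the first one sorted decreasingly.
module Submission where

open import Defs
open import Data.Bool using (if_then_else_; true; false)
open import Data.Fin using (Fin; zero; suc; toℕ)
open import Data.List using (List; []; _∷_; _++_; [_]; allFin; drop; filter; length; lookup; map; reverse; tabulate; upTo; zipWith)
open import Data.List.Extrema.Nat using (max; max≤v⁺; xs≤max)
open import Data.List.Membership.Propositional using (_∈_)
open import Data.List.Properties using (++-identityʳ; filter-none; length-zipWith; map-id; zipWith-map; map-++; map-∘; map-tabulate; tabulate-cong; unfold-reverse; upTo-∷ʳ)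
open import Data.List.Relation.Binary.Permutation.Propositional using (_↭_; ↭-reflexive; ↭-sym; ↭-trans; prep; ↭⇒↭ₛ; module PermutationReasoning)
open import Data.List.Relation.Binary.Permutation.Propositional.Properties using (All-resp-↭; drop-∷; drop-mid; map⁺; shift; ↭-empty-inv; ↭-reverse; ¬x∷xs↭[]; ++⁺)
open import Data.List.Relation.Binary.Pointwise using (Pointwise-≡⇒≡)
open import Data.List.Relation.Unary.All as All using (All; []; _∷_)
import Data.List.Relation.Unary.All.Properties as All
open import Data.List.Relation.Unary.AllPairs using (AllPairs; []; _∷_)
import Data.List.Relation.Unary.AllPairs.Properties as AllPairs
open import Data.List.Relation.Unary.Any using (here; there)
open import Data.List.Relation.Unary.Sorted.TotalOrder.Properties using (AllPairs⇒Sorted; ↗↭↗⇒≋)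
open import Data.List.Relation.Unary.Unique.Propositional using (Unique)
import Data.List.Sort as Sort
open import Data.Nat using (ℕ; zero; suc; _+_; _⊔_; _⊓_; _≤_; _<_; _≥_; _≤?_; _<?_; z≤n; s≤s)
open import Data.Nat.Induction using (Acc; acc; <-wellFounded)
open import Data.Nat.Properties using (+-mono-≤; +-mono-<-≤; +-mono-≤-<; +-suc; <⇒≤; <⇒≱; <⇒≯; ≤-decTotalOrder; ≤-refl; ≤-trans; ⊔-identityʳ; ⊔-lub; ⊓-idem; suc-injective; m≤m⊔n; m≤n⊔m; ≤-antisym; ≰⇒>)
open import Data.Product using (_×_; _,_)
open import Function using (_∘_)
open import Function.Bundles using (mk⇔)
open import Relation.Binary.Properties.DecTotalOrder ≤-decTotalOrder using (≥-decTotalOrder; ≥-totalOrder)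
open import Relation.Binary.PropositionalEquality using (_≡_; refl; sym; trans; cong; cong₂; module ≡-Reasoning)
open import Relation.Nullary using (¬_; Dec; does; yes; no; contradiction)
open import Relation.Nullary.Decidable using (_×-dec_; dec-true; dec-false; does-⇔)
open import Relation.Unary using (Decidable)

-- Left border numbers by recursion on the first letter.

count : ∀ {A : Set} → Dec A → ℕ
count a? = if does a? then 1 else 0

-- If x has left border number b in w, it has extend y x b in y ∷ w.
extend : ℕ → ℕ → ℕ → ℕ
extend y x zero    = count (x <? y)
extend y x (suc b) = suc (suc b)

greaterBefore? : (w : List ℕ) (i m : Fin (length w)) → Dec (position m < position i × lookup w i < lookup w m)
greaterBefore? w i m = (position m <? position i) ×-dec (lookup w i <? lookup w m)

-- A structurally recursive form of `tabulate (leftBorder w)`, so that later inductions run over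
-- words and not over positions in `Fin (length w)`.
borders : List ℕ → List ℕ
borders []      = []
borders (y ∷ w) = 0 ∷ zipWith (extend y) w (borders w)

max-∷ : ∀ x xs → max 0 (x ∷ xs) ≡ x ⊔ max 0 xs
max-∷ x xs = ≤-antisym
  (max≤v⁺ z≤n (m≤m⊔n x _ ∷ All.map (λ p → ≤-trans p (m≤n⊔m x _)) (xs≤max 0 xs)))
  (⊔-lub (All.head x∷xs≤) (max≤v⁺ z≤n (All.tail x∷xs≤)))
  where
  x∷xs≤ : All (_≤ max 0 (x ∷ xs)) (x ∷ xs)
  x∷xs≤ = xs≤max 0 (x ∷ xs)

-- The list must be nonempty: the maximum of the empty list is the base value 0, which does not
-- shift.
max-map-suc : ∀ x xs → max 0 (map suc (x ∷ xs)) ≡ suc (max 0 (x ∷ xs))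
max-map-suc x []        = trans (max-∷ (suc x) []) (cong suc (sym (trans (max-∷ x []) (⊔-identityʳ x))))
max-map-suc x (x′ ∷ xs) = begin
  max 0 (map suc (x ∷ x′ ∷ xs))        ≡⟨ max-∷ (suc x) (map suc (x′ ∷ xs)) ⟩
  suc x ⊔ max 0 (map suc (x′ ∷ xs))    ≡⟨ cong (suc x ⊔_) (max-map-suc x′ xs) ⟩
  suc (x ⊔ max 0 (x′ ∷ xs))            ≡⟨ cong suc (max-∷ x (x′ ∷ xs)) ⟨
  suc (max 0 (x ∷ x′ ∷ xs))            ∎
  where open ≡-Reasoning

-- Comparing only the Boolean outcomes lets shifted positions be handled by `refl`, since `_<?_` on
-- two successors computes to the same Boolean as on their predecessors.
filter-map : ∀ {A B : Set} {P : B → Set} {Q : A → Set} (P? : Decidable P) (Q? : Decidable Q) (f : A → B) →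
  (∀ x → does (P? (f x)) ≡ does (Q? x)) →
  ∀ xs → filter P? (map f xs) ≡ map f (filter Q? xs)
filter-map P? Q? f eq []       = refl
filter-map P? Q? f eq (x ∷ xs) rewrite eq x with does (Q? x)
... | true  = cong (f x ∷_) (filter-map P? Q? f eq xs)
... | false = filter-map P? Q? f eq xs

leftBorder-zero : ∀ y w → leftBorder (y ∷ w) zero ≡ 0
leftBorder-zero y w =
  cong (max 0 ∘ map position)
    (filter-none (greaterBefore? (y ∷ w) zero) {xs = allFin (suc (length w))} (All.universal (λ { m (s≤s () , _) }) _))

-- Here `ms` stands for the positions that compete for the border of `x`. Prepending `y` shifts them
-- by one and adds position 1 when `x < y`. That new position decides if `ms` is empty and is
-- dominated by a shifted one otherwise.
max-extend : ∀ {n} y x (ms : List (Fin n)) →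
  max 0 (map position (if does (x <? y) then zero ∷ map suc ms else map suc ms)) ≡
  extend y x (max 0 (map position ms))
max-extend y x [] with does (x <? y)
... | true  = refl
... | false = refl
max-extend y x (m ∷ ms) = begin
  max 0 (map position (if does (x <? y) then zero ∷ map suc (m ∷ ms) else map suc (m ∷ ms)))
    ≡⟨ head-absorbed (does (x <? y)) ⟩
  suc (suc k)
    ≡⟨ cong (extend y x) border ⟨
  extend y x (max 0 (map position (m ∷ ms))) ∎
  where
  open ≡-Reasoning

  -- The zero-based maximum; writing the border as `suc k` exposes the constructor on which `extend`
  -- branches.
  k : ℕ
  k = max 0 (map toℕ (m ∷ ms))

  border : max 0 (map position (m ∷ ms)) ≡ suc k
  border = trans (cong (max 0) (map-∘ (m ∷ ms))) (max-map-suc (toℕ m) (map toℕ ms))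

  shifted : max 0 (map position (map suc (m ∷ ms))) ≡ suc (suc k)
  shifted = trans (cong (max 0) (trans (sym (map-∘ (m ∷ ms))) (map-∘ (m ∷ ms))))
    (trans (max-map-suc (position m) (map position ms)) (cong suc border))

  head-absorbed : ∀ b → max 0 (map position (if b then zero ∷ map suc (m ∷ ms) else map suc (m ∷ ms))) ≡ suc (suc k)
  head-absorbed true  = trans (max-∷ 1 (map position (map suc (m ∷ ms)))) (cong (1 ⊔_) shifted)
  head-absorbed false = shifted

leftBorder-suc : ∀ y w i → leftBorder (y ∷ w) (suc i) ≡ extend y (lookup w i) (leftBorder w i)
leftBorder-suc y w i = trans (cong (max 0 ∘ map position) filters) (max-extend y (lookup w i) _)
  where
  later : filter (greaterBefore? (y ∷ w) (suc i)) (tabulate suc) ≡ map suc (filter (greaterBefore? w i) (allFin (length w)))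
  later = trans (cong (filter (greaterBefore? (y ∷ w) (suc i))) (sym (map-tabulate (λ m → m) suc)))
    (filter-map (greaterBefore? (y ∷ w) (suc i)) (greaterBefore? w i) suc (λ _ → refl) (allFin (length w)))

  filters : filter (greaterBefore? (y ∷ w) (suc i)) (allFin (suc (length w))) ≡
    (if does (lookup w i <? y) then zero ∷ map suc (filter (greaterBefore? w i) (allFin (length w)))
     else map suc (filter (greaterBefore? w i) (allFin (length w))))
  -- Position 1 lies before position `suc i` by computation, so only the comparison of letters
  -- decides whether `zero` is kept.
  filters with does (lookup w i <? y)
  ... | true  = cong (zero ∷_) later
  ... | false = later

zipWith-tabulate : ∀ {A B C : Set} (f : A → B → C) w (g : Fin (length w) → B) →
  zipWith f w (tabulate g) ≡ tabulate (λ i → f (lookup w i) (g i))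
zipWith-tabulate f []      g = refl
zipWith-tabulate f (x ∷ w) g = cong (f x (g zero) ∷_) (zipWith-tabulate f w (g ∘ suc))

tabulate-leftBorder : ∀ w → tabulate (leftBorder w) ≡ borders w
tabulate-leftBorder []      = refl
tabulate-leftBorder (y ∷ w) = cong₂ _∷_ (leftBorder-zero y w) (begin
  tabulate (leftBorder (y ∷ w) ∘ suc)                      ≡⟨ tabulate-cong (leftBorder-suc y w) ⟩
  tabulate (λ i → extend y (lookup w i) (leftBorder w i))  ≡⟨ zipWith-tabulate (extend y) w (leftBorder w) ⟨
  zipWith (extend y) w (tabulate (leftBorder w))           ≡⟨ cong (zipWith (extend y) w) (tabulate-leftBorder w) ⟩
  zipWith (extend y) w (borders w)                         ∎)
  where open ≡-Reasoning

leftBorders≡borders : ∀ {n} (π : 𝒮 n) → leftBorders π ≡ borders (word π)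
leftBorders≡borders π =
  trans (map-tabulate (λ i → i) (leftBorder (word π))) (tabulate-leftBorder (word π))

-- Splitting the borders at the largest letter.

extend-< : ∀ {x y} → x < y → ∀ b → extend y x b ≡ suc b
extend-< {x} {y} x<y zero    = cong (λ d → if d then 1 else 0) (dec-true (x <? y) x<y)
extend-< {x} {y} x<y (suc b) = refl

extend-> : ∀ {x y} → y < x → extend y x 0 ≡ 0
extend-> {x} {y} y<x = cong (λ d → if d then 1 else 0) (dec-false (x <? y) (<⇒≯ y<x))

length-borders : ∀ w → length (borders w) ≡ length w
length-borders []      = refl
length-borders (y ∷ w) = cong suc
  (trans (length-zipWith (extend y) w (borders w))
    (trans (cong (length w ⊓_) (length-borders w)) (⊓-idem (length w))))

zipWith-++ : ∀ {A B C : Set} (f : A → B → C) xs {ys} bs {cs} → length bs ≡ length xs →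
  zipWith f (xs ++ ys) (bs ++ cs) ≡ zipWith f xs bs ++ zipWith f ys cs
zipWith-++ f []       []       _  = refl
zipWith-++ f (x ∷ xs) (b ∷ bs) eq = cong (f x b ∷_) (zipWith-++ f xs bs (suc-injective eq))

zipWith-congˡ : ∀ {A B C : Set} {f : A → B → C} {g : B → C} {xs} → All (λ x → ∀ b → f x b ≡ g b) xs →
  ∀ bs → length bs ≡ length xs → zipWith f xs bs ≡ map g bs
zipWith-congˡ []         []       _  = refl
zipWith-congˡ (eq ∷ eqs) (b ∷ bs) l = cong₂ _∷_ (eq b) (zipWith-congˡ eqs bs (suc-injective l))

-- Induction on `L`. For empty `L`, the letter `m` exceeds all of `R`, so `extend m` is the
-- successor on every border there. A further letter `y < m` in front leaves the border of `m` at 0.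
borders-++ : ∀ {m} L {R} → All (_< m) L → All (_< m) R →
  borders (L ++ [ m ] ++ R) ≡ borders L ++ 0 ∷ map (suc (length L) +_) (borders R)
borders-++ []      {R} _           R<m =
  cong (0 ∷_) (zipWith-congˡ (All.map extend-< R<m) (borders R) (length-borders R))
borders-++ {m} (y ∷ L) {R} (y<m ∷ L<m) R<m = cong (0 ∷_) (begin
  zipWith (extend y) (L ++ [ m ] ++ R) (borders (L ++ [ m ] ++ R))
    ≡⟨ cong (zipWith (extend y) (L ++ [ m ] ++ R)) (borders-++ L L<m R<m) ⟩
  zipWith (extend y) (L ++ [ m ] ++ R) (borders L ++ 0 ∷ map (suc (length L) +_) (borders R))
    ≡⟨ zipWith-++ (extend y) L (borders L) (length-borders L) ⟩
  zipWith (extend y) L (borders L) ++ extend y m 0 ∷ zipWith (extend y) R (map (suc (length L) +_) (borders R))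
    ≡⟨ cong (zipWith (extend y) L (borders L) ++_) (cong₂ _∷_ (extend-> y<m) tail≡) ⟩
  zipWith (extend y) L (borders L) ++ 0 ∷ map (suc (suc (length L)) +_) (borders R) ∎)
  where
  open ≡-Reasoning

  -- Borders to the right of `m` are already successors, so `extend y` adds one whatever the letter
  -- is.
  tail≡ : zipWith (extend y) R (map (suc (length L) +_) (borders R)) ≡ map (suc (suc (length L)) +_) (borders R)
  tail≡ = begin
    zipWith (extend y) R (map (suc (length L) +_) (borders R))
      ≡⟨ cong (λ w → zipWith (extend y) w (map (suc (length L) +_) (borders R))) (map-id R) ⟨
    zipWith (extend y) (map (λ x → x) R) (map (suc (length L) +_) (borders R))
      ≡⟨ zipWith-map (extend y) (λ x → x) (suc (length L) +_) R (borders R) ⟩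
    zipWith (λ x b → extend y x (suc (length L) + b)) R (borders R)
      ≡⟨ zipWith-congˡ (All.universal (λ _ _ → refl) R) (borders R) (length-borders R) ⟩
    map (suc (suc (length L)) +_) (borders R) ∎

-- Invariance under standardization.

module _ (f : ℕ → ℕ) where

  -- Borders depend only on the outcomes of comparisons between letters. The hypothesis is confined
  -- to letters of `w` because `rank w` need not be strictly monotone elsewhere.
  borders-map : ∀ w → (∀ {x y} → x ∈ w → y ∈ w → does (f x <? f y) ≡ does (x <? y)) →
    borders (map f w) ≡ borders w
  borders-map []      _   = refl
  borders-map (y ∷ w) mono = cong (0 ∷_)
    (trans (cong (zipWith (extend (f y)) (map f w)) (borders-map w (λ x∈ y∈ → mono (there x∈) (there y∈))))
      (extend-map w (λ x∈ → mono (there x∈) (here refl)) (borders w)))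
    where
    extend-map : ∀ v → (∀ {x} → x ∈ v → does (f x <? f y) ≡ does (x <? y)) →
      ∀ bs → zipWith (extend (f y)) (map f v) bs ≡ zipWith (extend y) v bs
    extend-map []      _  _            = refl
    extend-map (x ∷ v) eq []           = refl
    extend-map (x ∷ v) eq (zero ∷ bs)  =
      cong₂ _∷_ (cong (λ d → if d then 1 else 0) (eq (here refl))) (extend-map v (eq ∘ there) bs)
    extend-map (x ∷ v) eq (suc b ∷ bs) = cong (_ ∷_) (extend-map v (eq ∘ there) bs)

count-mono-≤ : ∀ {A B : Set} → (A → B) → (a? : Dec A) (b? : Dec B) → count a? ≤ count b?
count-mono-≤ f (yes a) (yes _) = ≤-refl
count-mono-≤ f (yes a) (no ¬b) = contradiction (f a) ¬b
count-mono-≤ f (no _)  _       = z≤n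

count-mono-< : ∀ {A B : Set} → ¬ A → B → (a? : Dec A) (b? : Dec B) → count a? < count b?
count-mono-< ¬a b (yes a) _       = contradiction a ¬a
count-mono-< ¬a b (no _)  (yes _) = ≤-refl
count-mono-< ¬a b (no _)  (no ¬b) = contradiction b ¬b

rank-∷ : ∀ z w x → rank (z ∷ w) x ≡ count (z ≤? x) + rank w x
rank-∷ z w x with does (z ≤? x)
... | true  = refl
... | false = refl

rank-mono-≤ : ∀ w {x y} → x ≤ y → rank w x ≤ rank w y
rank-mono-≤ []      x≤y = z≤n
rank-mono-≤ (z ∷ w) {x} {y} x≤y rewrite rank-∷ z w x | rank-∷ z w y =
  +-mono-≤ (count-mono-≤ (λ z≤x → ≤-trans z≤x x≤y) (z ≤? x) (z ≤? y)) (rank-mono-≤ w x≤y)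

-- The letter `y` itself is counted in the rank of `y` but not in that of `x`.
rank-mono-< : ∀ {w x y} → y ∈ w → x < y → rank w x < rank w y
rank-mono-< {z ∷ w} {x} {y} y∈z∷w x<y rewrite rank-∷ z w x | rank-∷ z w y with y∈z∷w
... | here refl = +-mono-<-≤ (count-mono-< (<⇒≱ x<y) ≤-refl (z ≤? x) (z ≤? y)) (rank-mono-≤ w (<⇒≤ x<y))
... | there y∈w = +-mono-≤-< (count-mono-≤ (λ z≤x → ≤-trans z≤x (<⇒≤ x<y)) (z ≤? x) (z ≤? y)) (rank-mono-< y∈w x<y)

borders-standardize : ∀ w → borders (standardize w) ≡ borders w
borders-standardize w = borders-map (rank w) w λ {x} {y} _ y∈w →
  -- Weak monotonicity of the rank gives one direction by contraposition, strict monotonicity the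
  -- other.
  does-⇔ (mk⇔ (λ rx<ry → ≰⇒> (λ y≤x → <⇒≱ rx<ry (rank-mono-≤ w y≤x))) (rank-mono-< y∈w))
    (rank w x <? rank w y) (x <? y)

-- Row lengths of arbitrary paths.

rights : List Step → ℕ
rights []      = 0
rights (u ∷ p) = rights p
rights (r ∷ p) = suc (rights p)

rights-++ : ∀ p q → rights (p ++ q) ≡ rights p + rights q
rights-++ []      q = refl
rights-++ (u ∷ p) q = rights-++ p q
rights-++ (r ∷ p) q = cong suc (rights-++ p q)

rowLengths-++ : ∀ k p q → rowLengths k (p ++ q) ≡ rowLengths k p ++ rowLengths (rights p + k) q
rowLengths-++ k []      q = refl
rowLengths-++ k (u ∷ p) q = cong (k ∷_) (rowLengths-++ k p q)
rowLengths-++ k (r ∷ p) q = trans (rowLengths-++ (suc k) p q)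
  (cong (λ j → rowLengths (suc k) p ++ rowLengths j q) (+-suc (rights p) k))

rowLengths-+ : ∀ j k p → rowLengths (j + k) p ≡ map (j +_) (rowLengths k p)
rowLengths-+ j k []      = refl
rowLengths-+ j k (u ∷ p) = cong (j + k ∷_) (rowLengths-+ j k p)
rowLengths-+ j k (r ∷ p) =
  trans (cong (λ i → rowLengths i p) (sym (+-suc j k))) (rowLengths-+ j (suc k) p)

rowLengths-≥ : ∀ k p → All (k ≤_) (rowLengths k p)
rowLengths-≥ k []      = []
rowLengths-≥ k (u ∷ p) = ≤-refl ∷ rowLengths-≥ k p
rowLengths-≥ k (r ∷ p) = All.map <⇒≤ (rowLengths-≥ (suc k) p)

rowLengths-↗ : ∀ k p → AllPairs _≤_ (rowLengths k p)
rowLengths-↗ k []      = []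
rowLengths-↗ k (u ∷ p) = rowLengths-≥ k p ∷ rowLengths-↗ k p
rowLengths-↗ k (r ∷ p) = rowLengths-↗ (suc k) p

reverse-↘ : ∀ {xs} → AllPairs _≤_ xs → AllPairs _≥_ (reverse xs)
reverse-↘ []                   = []
reverse-↘ {x ∷ xs} (x≤xs ∷ xs↗) rewrite unfold-reverse x xs =
  AllPairs.++⁺ (reverse-↘ xs↗) ([] ∷ [])
    (All.map (_∷ []) (All-resp-↭ (↭-sym (↭-reverse xs)) x≤xs))

-- The recursion of `D` against the splitting at the largest letter.

rights-D : ∀ n (ac : Acc _<_ n) π → rights (D-rec n ac π) ≡ n
rights-D zero    _        π = refl
rights-D (suc n) (acc rs) π = begin
  rights (dL ++ r ∷ dR)                ≡⟨ rights-++ dL (r ∷ dR) ⟩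
  rights dL + suc (rights dR)          ≡⟨ cong₂ (λ i j → i + suc j) (rights-D _ (rs πL-shorter) _) (rights-D _ (rs πR-shorter) _) ⟩
  length πL + suc (length πR)          ≡⟨ +-suc (length πL) (length πR) ⟩
  suc (length πL + length πR)          ≡⟨ cong suc length-+ ⟩
  suc n                                ∎
  where
  open ≡-Reasoning
  open Decomposition (decompose π)
  dL = D-rec (length πL) (rs πL-shorter) ((πL *) {πL!})
  dR = D-rec (length πR) (rs πR-shorter) ((πR *) {πR!})

module _ {n} {π : 𝒮 (suc n)} (d : Decomposition π) where
  open Decomposition d

  -- Cancelling `suc n` from the word and from 1, ..., n + 1 leaves `πL ++ πR` as a rearrangement of
  -- 1, ..., n.
  πL++πR<1+n : All (_< suc n) (πL ++ πR)
  πL++πR<1+n = All-resp-↭ (↭-sym πL++πR↭) (All.map⁺ (All.map s≤s (All.all-upTo n)))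
    where
    πL++πR↭ : πL ++ πR ↭ map suc (upTo n)
    πL++πR↭ = ↭-trans
      (drop-mid πL (map suc (upTo n)) (↭-trans (↭-reflexive (sym word-≡))
        (↭-trans (isPermutation π) (↭-reflexive
          (trans (cong (map suc) (sym (upTo-∷ʳ n))) (map-++ suc (upTo n) [ n ]))))))
      (↭-reflexive (++-identityʳ _))

  borders-word : borders (word π) ≡ borders πL ++ 0 ∷ map (suc (length πL) +_) (borders πR)
  borders-word = trans (cong borders word-≡)
    (borders-++ πL (All.++⁻ˡ πL πL++πR<1+n) (All.++⁻ʳ πL πL++πR<1+n))

-- Stated for an arbitrary accessibility proof, so that the induction hypothesis fits the recursive
-- calls of `D-rec`.
rowLengths-D↭borders : ∀ n (ac : Acc _<_ n) π → rowLengths 0 (D-rec n ac π) ↭ borders (word π)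
rowLengths-D↭borders zero    _        π =
  ↭-reflexive (cong borders (sym (↭-empty-inv (isPermutation π))))
rowLengths-D↭borders (suc n) (acc rs) π = begin
  0 ∷ rowLengths 0 (dL ++ r ∷ dR)
    ≡⟨ cong (0 ∷_) (rowLengths-++ 0 dL (r ∷ dR)) ⟩
  0 ∷ rowLengths 0 dL ++ rowLengths (suc (rights dL + 0)) dR
    ≡⟨ cong (λ k → 0 ∷ rowLengths 0 dL ++ rowLengths (suc (k + 0)) dR) (rights-D _ (rs πL-shorter) _) ⟩
  0 ∷ rowLengths 0 dL ++ rowLengths (suc (length πL) + 0) dR
    ≡⟨ cong (λ xs → 0 ∷ rowLengths 0 dL ++ xs) (rowLengths-+ (suc (length πL)) 0 dR) ⟩
  0 ∷ rowLengths 0 dL ++ map (suc (length πL) +_) (rowLengths 0 dR)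
    ↭⟨ prep 0 (++⁺ (part πL (rs πL-shorter) πL!) (map⁺ _ (part πR (rs πR-shorter) πR!))) ⟩
  0 ∷ borders πL ++ map (suc (length πL) +_) (borders πR)
    -- The row of the leading `u` becomes the border 0 of the largest letter; the change of place is
    -- why only a permutation is obtained.
    ↭⟨ shift 0 (borders πL) _ ⟨
  borders πL ++ 0 ∷ map (suc (length πL) +_) (borders πR)
    ≡⟨ borders-word (decompose π) ⟨
  borders (word π) ∎
  where
  open PermutationReasoning
  open Decomposition (decompose π)
  dL = D-rec (length πL) (rs πL-shorter) ((πL *) {πL!})
  dR = D-rec (length πR) (rs πR-shorter) ((πR *) {πR!})

  part : ∀ w (ac : Acc _<_ (length w)) (w! : Unique w) →
    rowLengths 0 (D-rec (length w) ac ((w *) {w!})) ↭ borders w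
  part w ac w! = ↭-trans (rowLengths-D↭borders _ ac ((w *) {w!})) (↭-reflexive (borders-standardize w))

-- Sorting and the conclusion.

sort-unique : ∀ {xs ys} → AllPairs _≥_ xs → xs ↭ ys → xs ≡ sortDecreasing ys
sort-unique {xs} {ys} xs↘ xs↭ys = Pointwise-≡⇒≡
  (↗↭↗⇒≋ ≥-totalOrder (AllPairs⇒Sorted ≥-totalOrder xs↘) (Sort.sort-↗ ≥-decTotalOrder ys)
    (↭⇒↭ₛ (↭-trans xs↭ys (↭-sym (Sort.sort-↭ ≥-decTotalOrder ys)))))

-- Removing heads does not respect permutations in general, but here both heads are 0: the first
-- letter of a word has border 0.
drop-0-borders : ∀ {xs} w → 0 ∷ xs ↭ borders w → xs ↭ drop 1 (borders w)
drop-0-borders []      p = contradiction p ¬x∷xs↭[]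
drop-0-borders (_ ∷ _) p = drop-∷ p

drop-rowLengths-D↭borders : ∀ {n} (ac : Acc _<_ (suc n)) π →
  drop 1 (rowLengths 0 (D-rec (suc n) ac π)) ↭ drop 1 (borders (word π))
-- Matching on `acc` lets `D-rec` unfold to its leading `u`, whose row is the 0 to be cancelled.
drop-rowLengths-D↭borders ac@(acc _) π = drop-0-borders (word π) (rowLengths-D↭borders _ ac π)

proposition1p1 : (n : ℕ) → 1 ≤ n → (π : 𝒮 n) →
    Λ π ≡ sortDecreasing (drop 1 (leftBorders π))
proposition1p1 (suc n) _ π rewrite leftBorders≡borders π = sort-unique
  (reverse-↘ (AllPairs.drop⁺ 1 (rowLengths-↗ 0 (D π))))
  (↭-trans (↭-reverse _) (drop-rowLengths-D↭borders (<-wellFounded (suc n)) π))
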